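{- For $n\ge 1$, let $\operatorname{NE}_n(k)$ denote the number of permutations $\sigma\in\mathfrak{S}_n$ with nesting number $\operatorname{Ne}(\sigma)=k$. Then \[\operatorname{NE}_n(\lceil n/2\rceil)=\begin{cases} m! & \text{if } n=2m+1,\\ 2(m+1)!-(m-1)!-1 & \text{if } n=2m.\end{cases}\]
   Context: For $\sigma\in\mathfrak{S}_n$, the arcs of $\sigma$ are the pairs $(a,\sigma(a))$, $1\le a\le n$. A $k$-nesting of $\sigma$ is a set of $k$ arcs $\{(a_i,\sigma(a_i)):1\le i\le k\}$ satisfying either $a_1<a_2<\dots<a_k\le\sigma(a_k)<\dots<\sigma(a_2)<\sigma(a_1)$ (upper $k$-nesting; loops $a=\sigma(a)$ are allowed) or $\sigma(a_1)<\sigma(a_2)<\dots<\sigma(a_k)<a_k<\dots<a_2<a_1$ (lower $k$-nesting). The nesting number $\operatorname{Ne}(\sigma)$ is the largest $k$ such that $\sigma$ has a $k$-nesting. -}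

module Defs where

open import Data.Fin.Base using (Fin; toℕ; _<_; _≤_)
open import Data.Fin.Permutation using (Permutation′; _⟨$⟩ʳ_; _≈_)
open import Data.Nat.Base as ℕ using (ℕ; suc)
open import Data.Product.Base using (Σ-syntax; _×_; proj₁)
open import Data.Sum.Base using (_⊎_)
open import Function.Base using (_on_)
open import Function.Bundles using (Bijection)
open import Level using (0ℓ; Level)
open import Relation.Binary.Bundles using (Setoid)
open import Relation.Binary.PropositionalEquality using (_≡_; refl; sym; trans; setoid)

-- The points 1, …, n are represented by Fin n, and the k arcs of a nesting
-- by their sources a₁, …, aₖ, given as a map a : Fin k → Fin n.

-- a₁ < ⋯ < aₖ ≤ σ(aₖ) < ⋯ < σ(a₁).  The hypothesis suc (toℕ i) ≡ k selects
-- the last index, so that the middle comparison is vacuous when k = 0.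
record UpperNesting {n : ℕ} (σ : Permutation′ n) (k : ℕ) : Set where
  field
    a          : Fin k → Fin n
    increasing : ∀ {i j} → i < j → a i < a j
    innermost  : ∀ i → suc (toℕ i) ≡ k → a i ≤ σ ⟨$⟩ʳ a i
    decreasing : ∀ {i j} → i < j → σ ⟨$⟩ʳ a j < σ ⟨$⟩ʳ a i

-- σ(a₁) < ⋯ < σ(aₖ) < aₖ < ⋯ < a₁.
record LowerNesting {n : ℕ} (σ : Permutation′ n) (k : ℕ) : Set where
  field
    a          : Fin k → Fin n
    increasing : ∀ {i j} → i < j → σ ⟨$⟩ʳ a i < σ ⟨$⟩ʳ a j
    innermost  : ∀ i → suc (toℕ i) ≡ k → σ ⟨$⟩ʳ a i < a i
    decreasing : ∀ {i j} → i < j → a j < a i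

Nesting : {n : ℕ} → Permutation′ n → ℕ → Set
Nesting σ k = UpperNesting σ k ⊎ LowerNesting σ k

-- Ne(σ) = k.
HasNestingNumber : {n : ℕ} → Permutation′ n → ℕ → Set
HasNestingNumber σ k = Nesting σ k × (∀ j → Nesting σ j → j ℕ.≤ k)

-- {σ ∈ 𝔖ₙ : Ne(σ) = k}.  Permutations are compared pointwise and the evidence
-- for Ne(σ) = k is ignored by the equality, so each σ is counted once.
PermutationsWithNe : ℕ → ℕ → Setoid 0ℓ 0ℓ
PermutationsWithNe n k = record
  { Carrier       = Σ[ σ ∈ Permutation′ n ] HasNestingNumber σ k
  ; _≈_           = _≈_ on proj₁
  ; isEquivalence = record
    { refl  = λ _ → refl
    ; sym   = λ p i → sym (p i)
    ; trans = λ p q i → trans (p i) (q i)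
    }
  }

HasCardinality : {c ℓ : Level} → Setoid c ℓ → ℕ → Set _
HasCardinality S N = Bijection (setoid (Fin N)) S

-- NEₙ(k) = N.
NE_[_]≔_ : ℕ → ℕ → ℕ → Set
NE n [ k ]≔ N = HasCardinality (PermutationsWithNe n k) N

{-# OPTIONS --safe #-}
module Submission where

-- An upper nesting of k arcs aᵢ → σ(aᵢ) forces aᵢ ≥ i and σ(aᵢ) ≤ n + 1 − i, so for
-- k = ⌈n/2⌉ almost no freedom is left.  If n = 2m + 1, then σ(i) = n + 1 − i for
-- i ≤ m + 1 and the other m values are arbitrary.  If n = 2m, put
-- bᵢ = n + 1 − σ(aᵢ); the sequences a and b increase within {1, …, m + 1}, hence each
-- omits a single point, and at least one of them omits m + 1.  Each of the two
-- alternatives accounts for (m + 1) m! permutations, and m! + (m − 1)! are common to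
-- both.  Lower nestings force σ(n + 1 − i) = i for i ≤ m, which gives m! permutations,
-- of which only the reversal has an upper m-nesting.

open import Defs
open import Data.Fin.Base as Fin
  using (Fin; zero; suc; toℕ; fromℕ; opposite; punchIn; punchOut; _↑ˡ_; join; splitAt; combine; remQuot)
open import Data.Fin.Permutation as Perm using (Permutation′; _⟨$⟩ʳ_; _⟨$⟩ˡ_; insert; remove)
open import Data.Fin.Properties as Fin using (_≟_; all?; any?)
open import Data.Nat.Base
  using (ℕ; zero; suc; pred; _+_; _*_; _∸_; _≤_; _<_; _!; ⌈_/2⌉; z≤n; s≤s; s≤s⁻¹; >-nonZero)
open import Data.Nat.Properties hiding (_≟_)
open import Data.Product.Base using (∃-syntax; _×_; _,_; proj₁; proj₂; uncurry)
open import Data.Sum.Base using (_⊎_; inj₁; inj₂; [_,_]′)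
open import Function.Base using (_∘_; id)
open import Function.Definitions using (Injective)
open import Level using (0ℓ)
open import Relation.Binary.Bundles using (Setoid)
open import Relation.Binary.Definitions using (_Respects_)
open import Relation.Binary.PropositionalEquality
  using (_≡_; _≢_; refl; sym; trans; cong; cong₂; subst; subst₂; module ≡-Reasoning)
open import Relation.Nullary using (¬_; Dec; yes; no; contradiction)
open import Relation.Nullary.Decidable using (_⊎-dec_)
open import Relation.Unary using (Pred; Decidable; _∪_; _∩_; _∖_; _⊆_; U)

-- Counting predicates on a setoid

module Enumerations (S : Setoid 0ℓ 0ℓ) where
  open Setoid S using (Carrier; _≈_) renaming (sym to ≈-sym; trans to ≈-trans)

  -- Elements are compared by `≈` and proofs of `P` never are, which matches the equality of
  -- `PermutationsWithNe`.
  record Enumeration (P : Pred Carrier 0ℓ) (N : ℕ) : Set where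
    field
      element    : Fin N → Carrier
      member     : ∀ i → P (element i)
      injective  : ∀ {i j} → element i ≈ element j → i ≡ j
      surjective : ∀ {x} → P x → ∃[ i ] element i ≈ x

  open Enumeration

  private variable
    P Q R : Pred Carrier 0ℓ
    a b c : ℕ

  enumeration-⇔ : P ⊆ Q → Q ⊆ P → Enumeration P a → Enumeration Q a
  enumeration-⇔ P⊆Q Q⊆P e = record
    { element    = element e
    ; member     = P⊆Q ∘ member e
    ; injective  = injective e
    ; surjective = surjective e ∘ Q⊆P
    }

  enumeration-⊎ : (∀ {x y} → P x → Q y → ¬ x ≈ y) →
                  Enumeration P a → Enumeration Q b → Enumeration (P ∪ Q) (a + b)
  enumeration-⊎ {P} {Q} {a} {b} disjoint e f = record
    { element    = elt ∘ splitAt a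
    ; member     = mem ∘ splitAt a
    ; injective  = λ {i} {j} eq → trans (sym (Fin.join-splitAt a b i))
        (trans (cong (join a b) (inj (splitAt a i) (splitAt a j) eq)) (Fin.join-splitAt a b j))
    ; surjective = [ (λ p → sur (inj₁ (proj₁ (surjective e p))) (proj₂ (surjective e p)))
                   , (λ q → sur (inj₂ (proj₁ (surjective f q))) (proj₂ (surjective f q))) ]′
    }
    where
    elt : Fin a ⊎ Fin b → Carrier
    elt = [ element e , element f ]′

    mem : ∀ i → (P ∪ Q) (elt i)
    mem (inj₁ i) = inj₁ (member e i)
    mem (inj₂ j) = inj₂ (member f j)

    inj : ∀ i j → elt i ≈ elt j → i ≡ j
    inj (inj₁ i) (inj₁ j) eq = cong inj₁ (injective e eq)
    inj (inj₁ i) (inj₂ j) eq = contradiction eq (disjoint (member e i) (member f j))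
    inj (inj₂ i) (inj₁ j) eq = contradiction (≈-sym eq) (disjoint (member e j) (member f i))
    inj (inj₂ i) (inj₂ j) eq = cong inj₂ (injective f eq)

    sur : ∀ {x} i → elt i ≈ x → ∃[ j ] elt (splitAt a j) ≈ x
    sur {x} i eq = join a b i , subst (λ j → elt j ≈ x) (sym (Fin.splitAt-join a b i)) eq

  enumeration-Σ : ∀ {n} {P : Fin n → Pred Carrier 0ℓ} →
                  (∀ {v w x y} → P v x → P w y → x ≈ y → v ≡ w) →
                  (∀ v → Enumeration (P v) a) → Enumeration (λ x → ∃[ v ] P v x) (n * a)
  enumeration-Σ {a} {n} {P} disjoint e = record
    { element    = elt ∘ remQuot a
    ; member     = λ i → _ , member (e _) _
    ; injective  = λ {i} {j} eq → trans (sym (Fin.combine-remQuot {n} a i))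
        (trans (cong (uncurry combine) (inj (remQuot a i) (remQuot a j) eq)) (Fin.combine-remQuot {n} a j))
    ; surjective = λ { {x} (v , p) → let (i , eq) = surjective (e v) p in
        combine v i , subst (λ j → elt j ≈ x) (sym (Fin.remQuot-combine v i)) eq }
    }
    where
    elt : Fin n × Fin a → Carrier
    elt (v , i) = element (e v) i

    inj : ∀ i j → elt i ≈ elt j → i ≡ j
    inj (v , i) (w , j) eq with refl ← disjoint (member (e v) i) (member (e w) j) eq =
      cong (v ,_) (injective (e v) eq)

  enumeration-tail : (e : Enumeration P (suc a)) →
                     Enumeration (λ y → P y × ¬ element e zero ≈ y) a
  enumeration-tail {P} {a} e = record
    { element    = element e ∘ suc
    ; member     = λ i → member e (suc i) , λ eq → Fin.0≢1+n (injective e eq)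
    ; injective  = Fin.suc-injective ∘ injective e
    ; surjective = λ (p , x≉) → sur (surjective e p) x≉
    }
    where
    sur : ∀ {x} → ∃[ i ] element e i ≈ x → ¬ element e zero ≈ x → ∃[ i ] element e (suc i) ≈ x
    sur (zero  , eq) x≉ = contradiction eq x≉
    sur (suc i , eq) _  = i , eq

  enumeration-delete : ∀ {x} → P x → Enumeration P a →
                       ∃[ c ] Enumeration (λ y → P y × ¬ x ≈ y) c × suc c ≡ a
  enumeration-delete {a = zero}      p e = contradiction (proj₁ (surjective e p)) Fin.¬Fin0
  enumeration-delete {P} {a = suc a} {x} p e = a , record
    { element    = element e ∘ punchIn k
    ; member     = λ i → member e (punchIn k i) , λ eq →
        Fin.punchInᵢ≢i k i (sym (injective e (≈-trans k↦x eq)))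
    ; injective  = Fin.punchIn-injective k _ _ ∘ injective e
    ; surjective = λ (q , x≉y) → sur (surjective e q) x≉y
    } , refl
    where
    k   = proj₁ (surjective e p)
    k↦x = proj₂ (surjective e p)

    sur : ∀ {y} → ∃[ i ] element e i ≈ y → ¬ x ≈ y → ∃[ i ] element e (punchIn k i) ≈ y
    sur {y} (i , eq) x≉y = punchOut k≢i ,
      subst (λ j → element e j ≈ y) (sym (Fin.punchIn-punchOut k≢i)) eq
      where
      k≢i : k ≢ i
      k≢i refl = x≉y (≈-trans (≈-sym k↦x) eq)

  -- Induction on `b`: the first element of `R` is deleted from both predicates. The additive form
  -- `c + b ≡ a` keeps truncated subtraction out.
  enumeration-∖ : R Respects _≈_ → R ⊆ P → Enumeration P a → Enumeration R b →
                  ∃[ c ] Enumeration (P ∖ R) c × c + b ≡ a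
  enumeration-∖ {R} {P} {a} {zero} resp R⊆P e f =
    a , enumeration-⇔ (λ p → p , λ r → Fin.¬Fin0 (proj₁ (surjective f r))) proj₁ e , +-identityʳ a
  enumeration-∖ {R} {P} {a} {suc b} resp R⊆P e f
    with (a′ , e′ , refl) ← enumeration-delete (R⊆P (member f zero)) e
    with (c , g , refl) ← enumeration-∖
           (λ x≈y (r , ≉) → resp x≈y r , λ eq → ≉ (≈-trans eq (≈-sym x≈y)))
           (λ (r , ≉) → R⊆P r , ≉) e′ (enumeration-tail f)
    = c , enumeration-⇔
        (λ ((p , ≉) , ¬r) → p , λ r → ¬r (r , ≉))
        (λ (p , ¬r) → (p , λ eq → ¬r (resp eq (member f zero))) , λ (r , _) → ¬r r)
        g
    , +-suc c b

  -- The union splits into `P` and the part of `Q` outside `P ∩ Q`; deciding `P` tells on which side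
  -- a member of `Q` falls.
  inclusion-exclusion : Decidable P → P Respects _≈_ → Q Respects _≈_ →
                        Enumeration P a → Enumeration Q b → Enumeration (P ∩ Q) c →
                        ∃[ d ] Enumeration (P ∪ Q) d × d + c ≡ a + b
  inclusion-exclusion {P} {Q} {a} {b} {c} P? P-resp Q-resp e f g
    with (d , h , refl) ← enumeration-∖ {R = P ∩ Q} {P = Q}
           (λ eq (p , q) → P-resp eq p , Q-resp eq q) proj₂ f g
    = a + d
    , enumeration-⇔
        [ inj₁ , inj₂ ∘ proj₁ ]′
        (λ {x} → [ inj₁ , (λ q → cases q (P? x)) ]′)
        (enumeration-⊎ (λ p (q , ¬pq) eq → ¬pq (P-resp eq p , q)) e h)
    , +-assoc a d c
    where
    cases : ∀ {x} → Q x → Dec (P x) → (P ∪ (Q ∖ (P ∩ Q))) x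
    cases q (yes p) = inj₁ p
    cases q (no ¬p) = inj₂ (q , ¬p ∘ proj₁)

-- Permutations with prescribed values

permutations : ℕ → Setoid 0ℓ 0ℓ
permutations n = record
  { Carrier       = Permutation′ n
  ; _≈_           = Perm._≈_
  ; isEquivalence = record
    { refl  = λ _ → refl
    ; sym   = λ p i → sym (p i)
    ; trans = λ p q i → trans (p i) (q i)
    }
  }

module _ {n : ℕ} where
  open Enumerations (permutations n) public
open Enumeration

private variable
  k n r N : ℕ

⟨$⟩ʳ-injective : (σ : Permutation′ n) → Injective _≡_ _≡_ (σ ⟨$⟩ʳ_)
⟨$⟩ʳ-injective σ eq = trans (sym (Perm.inverseˡ σ)) (trans (cong (σ ⟨$⟩ˡ_) eq) (Perm.inverseˡ σ))

insert-at : ∀ i j (π : Permutation′ n) → insert i j π ⟨$⟩ʳ i ≡ j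
insert-at i j π with i ≟ i
... | yes _  = refl
... | no i≢i = contradiction refl i≢i

insert-cong : ∀ i j {π ρ : Permutation′ n} → π Perm.≈ ρ → insert i j π Perm.≈ insert i j ρ
insert-cong i j π≈ρ k with i ≟ k
... | yes _ = refl
... | no  _ = cong (punchIn j) (π≈ρ _)

enumeration-insert : ∀ i j {Q : Pred (Permutation′ n) 0ℓ} → Enumeration Q N →
                     Enumeration (λ σ → ∃[ π ] Q π × insert i j π Perm.≈ σ) N
enumeration-insert i j e = record
  { element    = insert i j ∘ element e
  ; member     = λ l → element e l , member e l , λ _ → refl
  ; injective  = λ eq → injective e λ l → Fin.punchIn-injective j _ _
      (trans (sym (Perm.insert-punchIn i j _ l)) (trans (eq (punchIn i l)) (Perm.insert-punchIn i j _ l)))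
  ; surjective = λ (π , q , eq) → let (l , eq′) = surjective e q in
      l , λ x → trans (insert-cong i j {ρ = π} eq′ x) (eq x)
  }

remove-insertion : ∀ i {j} (σ : Permutation′ (suc n)) → σ ⟨$⟩ʳ i ≡ j → insert i j (remove i σ) Perm.≈ σ
remove-insertion i σ refl = Perm.insert-remove i σ

enumeration-all : ∀ n → Enumeration {n} U (n !)
enumeration-all zero    = record
  { element    = λ _ → Perm.id
  ; member     = λ _ → _
  ; injective  = λ { {zero} {zero} _ → refl }
  ; surjective = λ _ → zero , λ ()
  }
enumeration-all (suc n) = enumeration-⇔ (λ _ → _)
  (λ {σ} _ → σ ⟨$⟩ʳ zero , remove zero σ , _ , remove-insertion zero σ refl)
  (enumeration-Σ
    (λ {v} {w} (π , _ , eq) (ρ , _ , eq′) x≈y →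
      trans (sym (insert-at zero v π))
        (trans (trans (eq zero) (trans (x≈y zero) (sym (eq′ zero)))) (insert-at zero w ρ)))
    (λ v → enumeration-insert zero v (enumeration-all n)))

-- All extremal families below are built from predicates of this form.
Match : (f g : Fin k → Fin n) → Pred (Permutation′ n) 0ℓ
Match f g σ = ∀ i → σ ⟨$⟩ʳ f i ≡ g i

match? : (f g : Fin k → Fin n) → Decidable (Match f g)
match? f g σ = all? λ i → σ ⟨$⟩ʳ f i ≟ g i

match-resp : (f g : Fin k → Fin n) → Match f g Respects Perm._≈_
match-resp f g eq s i = trans (sym (eq (f i))) (s i)

-- Induction on `k`: the first prescribed arc is removed and the other prescriptions are renumbered
-- by `punchOut`; once none is left, `r` points are free.
enumeration-match : (f g : Fin k → Fin n) → Injective _≡_ _≡_ f → Injective _≡_ _≡_ g →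
                    k + r ≡ n → Enumeration (Match f g) (r !)
enumeration-match {zero} {r = r} f g f-inj g-inj refl = enumeration-⇔ (λ _ ()) _ (enumeration-all r)
enumeration-match {suc k} {r = r} f g f-inj g-inj refl = enumeration-⇔
  (λ { {σ} (π , s , eq) zero    → trans (sym (eq (f zero))) (insert-at (f zero) (g zero) π)
     ; {σ} (π , s , eq) (suc i) → trans (sym (eq (f (suc i)))) (extend π s i) })
  (λ {σ} s → remove (f zero) σ , restrict σ s , remove-insertion (f zero) σ (s zero))
  (enumeration-insert (f zero) (g zero)
    (enumeration-match f′ g′
      (λ {i} {j} eq → Fin.suc-injective (f-inj (Fin.punchOut-injective (f≢ i) (f≢ j) eq)))
      (λ {i} {j} eq → Fin.suc-injective (g-inj (Fin.punchOut-injective (g≢ i) (g≢ j) eq)))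
      refl))
  where
  f≢ : ∀ i → f zero ≢ f (suc i)
  f≢ i eq = Fin.0≢1+n (f-inj eq)

  g≢ : ∀ i → g zero ≢ g (suc i)
  g≢ i eq = Fin.0≢1+n (g-inj eq)

  f′ g′ : Fin k → Fin (k + r)
  f′ i = punchOut (f≢ i)
  g′ i = punchOut (g≢ i)

  extend : ∀ π → Match f′ g′ π → ∀ i → insert (f zero) (g zero) π ⟨$⟩ʳ f (suc i) ≡ g (suc i)
  extend π s i = trans (cong (insert (f zero) (g zero) π ⟨$⟩ʳ_) (sym (Fin.punchIn-punchOut (f≢ i))))
    (trans (Perm.insert-punchIn (f zero) (g zero) π (f′ i))
      (trans (cong (punchIn (g zero)) (s i)) (Fin.punchIn-punchOut (g≢ i))))

  restrict : ∀ σ → Match f g σ → Match f′ g′ (remove (f zero) σ)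
  restrict σ s i = Fin.punchIn-injective (g zero) _ _
    (trans (sym (Perm.insert-punchIn (f zero) (g zero) (remove (f zero) σ) (f′ i)))
      (trans (remove-insertion (f zero) σ (s zero) _)
        (trans (cong (σ ⟨$⟩ʳ_) (Fin.punchIn-punchOut (f≢ i)))
          (trans (s (suc i)) (sym (Fin.punchIn-punchOut (g≢ i)))))))

-- Strictly increasing sequences with little slack

StrictlyIncreasing : (Fin k → ℕ) → Set
StrictlyIncreasing f = ∀ {i j} → i Fin.< j → f i < f j

strictlyIncreasing-∘suc : {f : Fin (suc k) → ℕ} → StrictlyIncreasing f → StrictlyIncreasing (f ∘ suc)
strictlyIncreasing-∘suc inc i<j = inc (s≤s i<j)

first+index≤value : (f : Fin (suc k) → ℕ) → StrictlyIncreasing f → ∀ i → f zero + toℕ i ≤ f i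
first+index≤value f inc zero = ≤-reflexive (+-identityʳ (f zero))
first+index≤value {suc k} f inc (suc i) = begin
  f zero + suc (toℕ i)    ≡⟨ +-suc (f zero) (toℕ i) ⟩
  suc (f zero) + toℕ i    ≤⟨ +-monoˡ-≤ (toℕ i) (inc (s≤s z≤n)) ⟩
  f (suc zero) + toℕ i    ≤⟨ first+index≤value (f ∘ suc) (strictlyIncreasing-∘suc inc) i ⟩
  f (suc i)               ∎
  where open ≤-Reasoning

index≤value : (f : Fin k → ℕ) → StrictlyIncreasing f → ∀ i → toℕ i ≤ f i
index≤value {suc k} f inc i = ≤-trans (m≤n+m (toℕ i) (f zero)) (first+index≤value f inc i)

last-index≤value : (a : Fin (suc k) → Fin n) → StrictlyIncreasing (toℕ ∘ a) → k ≤ toℕ (a (fromℕ k))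
last-index≤value {k} a inc =
  subst (_≤ toℕ (a (fromℕ k))) (Fin.toℕ-fromℕ k) (index≤value (toℕ ∘ a) inc (fromℕ k))

value+length≤last+index : (f : Fin (suc k) → ℕ) → StrictlyIncreasing f →
                          ∀ i → f i + k ≤ f (fromℕ k) + toℕ i
value+length≤last+index {zero}  f inc zero = ≤-refl
value+length≤last+index {suc k} f inc zero = begin
  f zero + suc k                      ≡⟨ +-suc (f zero) k ⟩
  suc (f zero) + k                    ≤⟨ +-monoˡ-≤ k (inc (s≤s z≤n)) ⟩
  f (suc zero) + k                    ≤⟨ value+length≤last+index (f ∘ suc) (strictlyIncreasing-∘suc inc) zero ⟩
  f (fromℕ (suc k)) + 0               ∎
  where open ≤-Reasoning
value+length≤last+index {suc k} f inc (suc i) = begin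
  f (suc i) + suc k                   ≡⟨ +-suc (f (suc i)) k ⟩
  suc (f (suc i) + k)                 ≤⟨ s≤s (value+length≤last+index (f ∘ suc) (strictlyIncreasing-∘suc inc) i) ⟩
  suc (f (fromℕ (suc k)) + toℕ i)     ≡⟨ +-suc _ (toℕ i) ⟨
  f (fromℕ (suc k)) + suc (toℕ i)     ∎
  where open ≤-Reasoning

-- The excess of value over index never decreases, so a bound `d` on it at the last index holds
-- everywhere. Later `d = 0` forces the identity and `d = 1` leaves room for one omitted point.
value≤gap+index : (f : Fin (suc k) → ℕ) → StrictlyIncreasing f →
                  ∀ d → f (fromℕ k) ≤ d + k → ∀ i → f i ≤ d + toℕ i
value≤gap+index {k} f inc d bound i = +-cancelʳ-≤ k _ _ (begin
  f i + k                ≤⟨ value+length≤last+index f inc i ⟩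
  f (fromℕ k) + toℕ i    ≤⟨ +-monoˡ-≤ (toℕ i) bound ⟩
  d + k + toℕ i          ≡⟨ +-assoc d k (toℕ i) ⟩
  d + (k + toℕ i)        ≡⟨ cong (d +_) (+-comm k (toℕ i)) ⟩
  d + (toℕ i + k)        ≡⟨ +-assoc d (toℕ i) k ⟨
  d + toℕ i + k          ∎)
  where open ≤-Reasoning

strictlyIncreasing⇒identity : (f : Fin (suc k) → ℕ) → StrictlyIncreasing f →
                              f (fromℕ k) ≤ k → ∀ i → f i ≡ toℕ i
strictlyIncreasing⇒identity f inc bound i =
  ≤-antisym (value≤gap+index f inc 0 bound i) (index≤value f inc i)

-- The excess of value over index is 0 or 1 and never falls, so it jumps at most once; `u` is the
-- value skipped there, or the last one if there is no jump.
strictlyIncreasing⇒punchIn : (f : Fin k → ℕ) → StrictlyIncreasing f →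
                             (∀ i → f i ≤ suc (toℕ i)) →
                             ∃[ u ] ∀ i → f i ≡ toℕ (punchIn u i)
strictlyIncreasing⇒punchIn {zero}  f inc bound = zero , λ ()
strictlyIncreasing⇒punchIn {suc k} f inc bound with f zero in f0≡
-- A positive start uses up the whole slack at once, so the omitted value is 0.
... | suc v = zero , λ i → ≤-antisym (bound i)
  (≤-trans (+-monoˡ-≤ (toℕ i) (subst (1 ≤_) (sym f0≡) (s≤s z≤n))) (first+index≤value f inc i))
-- The recursion runs on the remaining terms lowered by one, hence the `suc` on its omitted value.
... | zero  = suc (proj₁ rest) , λ where
    zero    → f0≡
    (suc i) → trans (sym (suc-pred′ i)) (cong suc (proj₂ rest i))
  where
  suc-pred′ : ∀ i → suc (pred (f (suc i))) ≡ f (suc i)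
  suc-pred′ i = suc-pred (f (suc i)) {{>-nonZero (≤-<-trans z≤n (inc {zero} {suc i} (s≤s z≤n)))}}

  rest : ∃[ u ] ∀ i → pred (f (suc i)) ≡ toℕ (punchIn u i)
  rest = strictlyIncreasing⇒punchIn (pred ∘ f ∘ suc)
    (λ {i} {j} i<j → s≤s⁻¹ (subst₂ _<_ (sym (suc-pred′ i)) (sym (suc-pred′ j)) (inc (s≤s i<j))))
    (λ i → pred-mono-≤ (bound (suc i)))

-- The reflection `opposite`

opposite-sum : (i : Fin n) → toℕ (opposite i) + suc (toℕ i) ≡ n
opposite-sum {n} i = trans (cong (_+ suc (toℕ i)) (Fin.opposite-prop i)) (m∸n+n≡m (Fin.toℕ<n i))

opposite-antitone : {i j : Fin n} → i Fin.< j → opposite j Fin.< opposite i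
opposite-antitone {n} {i} {j} i<j = subst₂ _<_ (sym (Fin.opposite-prop j)) (sym (Fin.opposite-prop i))
  (∸-monoʳ-< (s≤s i<j) (Fin.toℕ<n j))

opposite-injective : Injective _≡_ _≡_ (opposite {n})
opposite-injective {_} {i} {j} eq =
  trans (sym (Fin.opposite-involutive i)) (trans (cong opposite eq) (Fin.opposite-involutive j))

-- Counting from 0, `opposite j` is n - 1 - j, so a comparison with it is a bound on a sum.
+<⇒≤opposite : (i j : Fin n) → toℕ i + toℕ j < n → i Fin.≤ opposite j
+<⇒≤opposite {n} i j lt = +-cancelʳ-≤ (suc (toℕ j)) _ _
  (subst₂ _≤_ (sym (+-suc (toℕ i) (toℕ j))) (sym (opposite-sum j)) lt)

≤opposite⇒+< : (i j : Fin n) → i Fin.≤ opposite j → toℕ i + toℕ j < n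
≤opposite⇒+< {n} i j le =
  subst₂ _≤_ (+-suc (toℕ i) (toℕ j)) (opposite-sum j) (+-monoˡ-≤ (suc (toℕ j)) le)

<opposite⇒1++< : (i j : Fin n) → i Fin.< opposite j → suc (toℕ j + toℕ i) < n
<opposite⇒1++< i j lt = subst₂ _≤_
  (cong suc (trans (+-suc (toℕ i) (toℕ j)) (cong suc (+-comm (toℕ i) (toℕ j)))))
  (opposite-sum j) (+-monoˡ-≤ (suc (toℕ j)) lt)

1++<⇒<opposite : (i j : Fin n) → suc (toℕ j + toℕ i) < n → i Fin.< opposite j
1++<⇒<opposite i j lt = +-cancelʳ-≤ (suc (toℕ j)) _ _
  (subst₂ _≤_ (cong suc (trans (cong suc (+-comm (toℕ j) (toℕ i))) (sym (+-suc (toℕ i) (toℕ j)))))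
    (sym (opposite-sum j)) lt)

-- Nestings as pairs of increasing sequences

last-index : (i : Fin (suc k)) → suc (toℕ i) ≡ suc k → i ≡ fromℕ k
last-index i eq = Fin.toℕ-injective (trans (suc-injective eq) (sym (Fin.toℕ-fromℕ _)))

-- The i-th arc goes from a i to opposite (b i), so that a and b count positions
-- from the two ends and the nesting condition becomes symmetric in them.
UpperPair : Permutation′ n → (k : ℕ) → (a b : Fin (suc k) → Fin n) → Set
UpperPair {n} σ k a b =
  StrictlyIncreasing (toℕ ∘ a) × StrictlyIncreasing (toℕ ∘ b) ×
  toℕ (a (fromℕ k)) + toℕ (b (fromℕ k)) < n × Match a (opposite ∘ b) σ

-- Sources are now counted from the right end and targets from the left; the extra `suc` expresses
-- that a lower nesting has no loop.
LowerPair : Permutation′ n → (k : ℕ) → (a b : Fin (suc k) → Fin n) → Set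
LowerPair {n} σ k a b =
  StrictlyIncreasing (toℕ ∘ a) × StrictlyIncreasing (toℕ ∘ b) ×
  suc (toℕ (a (fromℕ k)) + toℕ (b (fromℕ k))) < n × Match (opposite ∘ a) b σ

module _ {σ : Permutation′ n} where

  upperNesting⇒pair : UpperNesting σ (suc k) → ∃[ a ] ∃[ b ] UpperPair σ k a b
  upperNesting⇒pair {k} N = a , b , increasing , (opposite-antitone ∘ decreasing) ,
    ≤opposite⇒+< (a (fromℕ k)) (b (fromℕ k))
      (subst (a (fromℕ k) Fin.≤_) (sym (Fin.opposite-involutive _))
        (innermost (fromℕ k) (cong suc (Fin.toℕ-fromℕ k)))) ,
    (λ i → sym (Fin.opposite-involutive _))
    where
    open UpperNesting N
    b : Fin (suc k) → Fin n
    b i = opposite (σ ⟨$⟩ʳ a i)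

  pair⇒upperNesting : ∀ {a b} → UpperPair σ k a b → UpperNesting σ (suc k)
  pair⇒upperNesting {k} {a} {b} (a-inc , b-inc , sum< , s) = record
    { a          = a
    ; increasing = a-inc
    ; innermost  = λ i eq → subst (λ i → a i Fin.≤ σ ⟨$⟩ʳ a i) (sym (last-index i eq))
        (subst (a (fromℕ k) Fin.≤_) (sym (s (fromℕ k))) (+<⇒≤opposite _ _ sum<))
    ; decreasing = λ {i} {j} i<j → subst₂ Fin._<_ (sym (s j)) (sym (s i)) (opposite-antitone (b-inc i<j))
    }

  lowerNesting⇒pair : LowerNesting σ (suc k) → ∃[ a ] ∃[ b ] LowerPair σ k a b
  lowerNesting⇒pair {k} N = b , (λ i → σ ⟨$⟩ʳ a i) , (opposite-antitone ∘ decreasing) , increasing ,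
    <opposite⇒1++< (σ ⟨$⟩ʳ a (fromℕ k)) (b (fromℕ k))
      (subst (σ ⟨$⟩ʳ a (fromℕ k) Fin.<_) (sym (Fin.opposite-involutive _))
        (innermost (fromℕ k) (cong suc (Fin.toℕ-fromℕ k)))) ,
    (λ i → cong (σ ⟨$⟩ʳ_) (Fin.opposite-involutive _))
    where
    open LowerNesting N
    b : Fin (suc k) → Fin n
    b i = opposite (a i)

  pair⇒lowerNesting : ∀ {a b} → LowerPair σ k a b → LowerNesting σ (suc k)
  pair⇒lowerNesting {k} {a} {b} (a-inc , b-inc , sum< , s) = record
    { a          = opposite ∘ a
    ; increasing = λ {i} {j} i<j → subst₂ Fin._<_ (sym (s i)) (sym (s j)) (b-inc i<j)
    ; innermost  = λ i eq → subst (λ i → σ ⟨$⟩ʳ opposite (a i) Fin.< opposite (a i)) (sym (last-index i eq))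
        (subst (Fin._< opposite (a (fromℕ k))) (sym (s (fromℕ k)))
          (1++<⇒<opposite (b (fromℕ k)) (a (fromℕ k)) sum<))
    ; decreasing = opposite-antitone ∘ a-inc
    }

  -- Both sequences of the pair end at a value of at least `k`, while the sum of these values is
  -- below `n`.
  nesting-bound : ∀ j → Nesting σ j → j ≤ ⌈ n /2⌉
  nesting-bound zero    N = z≤n
  -- `⌈ suc (k + k) /2⌉` unfolds to `suc ⌊ k + k /2⌋`, which equals `suc k`.
  nesting-bound (suc k) N = subst (_≤ ⌈ n /2⌉) (cong suc (sym (n≡⌊n+n/2⌋ k))) (⌈n/2⌉-mono (2k<n N))
    where
    2k<n : Nesting σ (suc k) → k + k < n
    2k<n (inj₁ N) with (a , b , a-inc , b-inc , sum< , _) ← upperNesting⇒pair N =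
      ≤-<-trans (+-mono-≤ (last-index≤value a a-inc) (last-index≤value b b-inc)) sum<
    2k<n (inj₂ N) with (a , b , a-inc , b-inc , sum< , _) ← lowerNesting⇒pair N =
      ≤-<-trans (+-mono-≤ (last-index≤value a a-inc) (last-index≤value b b-inc)) (<-trans (n<1+n _) sum<)

-- By `nesting-bound` nothing larger can occur, so possessing a nesting of this size already fixes
-- the nesting number.
enumeration⇒NE : Enumeration {n} (λ σ → Nesting σ k) N → k ≡ ⌈ n /2⌉ → NE n [ ⌈ n /2⌉ ]≔ N
enumeration⇒NE e refl = record
  { to        = λ i → element e i , member e i , nesting-bound
  ; cong      = λ { refl _ → refl }
  ; bijective = injective e , λ (σ , nesting , _) → let (i , eq) = surjective e nesting in
      i , λ { refl → eq }
  }

-- Initial sequences that omit one point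

toℕ-punchIn-fromℕ : ∀ k (i : Fin k) → toℕ (punchIn (fromℕ k) i) ≡ toℕ i
toℕ-punchIn-fromℕ (suc k) zero    = refl
toℕ-punchIn-fromℕ (suc k) (suc i) = cong suc (toℕ-punchIn-fromℕ k i)

punchIn-fromℕ : ∀ k (u : Fin (suc (suc k))) → u ≢ fromℕ (suc k) → punchIn u (fromℕ k) ≡ fromℕ (suc k)
punchIn-fromℕ k       zero       u≢ = refl
punchIn-fromℕ zero    (suc zero) u≢ = contradiction refl u≢
punchIn-fromℕ (suc k) (suc u)    u≢ = cong suc (punchIn-fromℕ k u (u≢ ∘ cong suc))

-- Omitting the last point or the last but one gives sequences that differ only in their last term.
punchIn-penultimate : ∀ k (i : Fin (suc k)) → i ≢ fromℕ k →
  punchIn (punchIn (fromℕ (suc k)) (fromℕ k)) i ≡ punchIn (fromℕ (suc k)) i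
punchIn-penultimate zero    zero    i≢ = contradiction refl i≢
punchIn-penultimate (suc k) zero    i≢ = refl
punchIn-penultimate (suc k) (suc i) i≢ = cong suc (punchIn-penultimate k i (i≢ ∘ cong suc))

punchIn-mono-< : ∀ (u : Fin (suc k)) {i j} → i Fin.< j → punchIn u i Fin.< punchIn u j
punchIn-mono-< u {i} {j} i<j = ≰⇒> (<⇒≱ i<j ∘ Fin.punchIn-cancel-≤ u j i)

-- For `u ≢ v` the point `v` is attained by `punchIn u` but omitted by `punchIn v`.
punchIn-injectiveˡ : {u v : Fin (suc k)} → (∀ i → punchIn u i ≡ punchIn v i) → u ≡ v
punchIn-injectiveˡ {u = u} {v} eq with u ≟ v
... | yes u≡v = u≡v
... | no  u≢v = contradiction
  (trans (sym (eq (punchOut u≢v))) (Fin.punchIn-punchOut u≢v)) (Fin.punchInᵢ≢i v _)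

-- Odd n = 2m + 1

module Odd (m : ℕ) where

  low : Fin (suc m) → Fin (suc m + m)
  low i = i ↑ˡ m

  Extremal : Pred (Permutation′ (suc m + m)) 0ℓ
  Extremal = Match low (opposite ∘ low)

  low-increasing : StrictlyIncreasing (toℕ ∘ low)
  low-increasing = subst₂ _<_ (sym (Fin.toℕ-↑ˡ _ m)) (sym (Fin.toℕ-↑ˡ _ m))

  toℕ-low-last : toℕ (low (fromℕ m)) ≡ m
  toℕ-low-last = trans (Fin.toℕ-↑ˡ (fromℕ m) m) (Fin.toℕ-fromℕ m)

  extremal⇒nesting : ∀ {σ} → Extremal σ → Nesting σ (suc m)
  extremal⇒nesting s = inj₁ (pair⇒upperNesting
    (low-increasing , low-increasing , s≤s (≤-reflexive (cong₂ _+_ toℕ-low-last toℕ-low-last)) , s))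

  identity-low : (a : Fin (suc m) → Fin (suc m + m)) → StrictlyIncreasing (toℕ ∘ a) →
                 toℕ (a (fromℕ m)) ≤ m → ∀ i → a i ≡ low i
  identity-low a inc bound i = Fin.toℕ-injective
    (trans (strictlyIncreasing⇒identity (toℕ ∘ a) inc bound i) (sym (Fin.toℕ-↑ˡ i m)))

  -- The last terms of `a` and `b` are each at least m and sum to at most 2m, so both equal m and
  -- both sequences are `low`.
  nesting⇒extremal : ∀ {σ} → Nesting σ (suc m) → Extremal σ
  nesting⇒extremal {σ} (inj₁ N) with (a , b , a-inc , b-inc , s≤s sum≤ , s) ← upperNesting⇒pair N = λ i →
    trans (cong (σ ⟨$⟩ʳ_) (sym (identity-low a a-inc a≤ i)))
          (trans (s i) (cong opposite (identity-low b b-inc b≤ i)))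
    where
    a≤ : toℕ (a (fromℕ m)) ≤ m
    a≤ = +-cancelʳ-≤ m _ _ (≤-trans (+-monoʳ-≤ _ (last-index≤value b b-inc)) sum≤)
    b≤ : toℕ (b (fromℕ m)) ≤ m
    b≤ = +-cancelˡ-≤ m _ _ (≤-trans (+-monoˡ-≤ _ (last-index≤value a a-inc)) sum≤)
  -- A lower nesting of this size involves 2m + 2 distinct points, one more than there are.
  nesting⇒extremal {σ} (inj₂ N) with (a , b , a-inc , b-inc , s≤s sum< , _) ← lowerNesting⇒pair N =
    contradiction (+-mono-≤ (last-index≤value a a-inc) (last-index≤value b b-inc)) (<⇒≱ sum<)

  NE-odd : NE (suc m + m) [ ⌈ suc m + m /2⌉ ]≔ (m !)
  NE-odd = enumeration⇒NE
    (enumeration-⇔ extremal⇒nesting nesting⇒extremal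
      (enumeration-match low (opposite ∘ low) low-injective (low-injective ∘ opposite-injective) refl))
    (cong suc (n≡⌊n+n/2⌋ m))
    where
    low-injective : Injective _≡_ _≡_ low
    low-injective = Fin.↑ˡ-injective m _ _

-- Even n = 2m, with m = p + 1

module Even (p : ℕ) where

  private
    -- This form of 2m splits off the first m + 1 points, which contain both sequences of an
    -- extremal nesting.
    n′ = suc (suc p) + p

  low : Fin (suc (suc p)) → Fin n′
  low j = j ↑ˡ p

  low-injective : Injective _≡_ _≡_ low
  low-injective = Fin.↑ˡ-injective p _ _

  -- Counting from 1, the points m + 1 and m, which `opposite` interchanges after `low`. By
  -- definition `low pen` is the last term of `omit last`.
  last pen : Fin (suc (suc p))
  last = fromℕ (suc p)
  pen  = punchIn last (fromℕ p)

  pen≢last : pen ≢ last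
  pen≢last = Fin.punchInᵢ≢i last (fromℕ p)

  omit : Fin (suc (suc p)) → Fin (suc p) → Fin n′
  omit u i = low (punchIn u i)

  omit-injective : ∀ u → Injective _≡_ _≡_ (omit u)
  omit-injective u = Fin.punchIn-injective u _ _ ∘ low-injective

  omit-increasing : ∀ u → StrictlyIncreasing (toℕ ∘ omit u)
  omit-increasing u i<j = subst₂ _<_ (sym (Fin.toℕ-↑ˡ _ p)) (sym (Fin.toℕ-↑ˡ _ p)) (punchIn-mono-< u i<j)

  toℕ-omit-last : ∀ i → toℕ (omit last i) ≡ toℕ i
  toℕ-omit-last i = trans (Fin.toℕ-↑ˡ _ p) (toℕ-punchIn-fromℕ (suc p) i)

  toℕ-low-pen : toℕ (low pen) ≡ p
  toℕ-low-pen = trans (toℕ-omit-last (fromℕ p)) (Fin.toℕ-fromℕ p)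

  toℕ-omit≤ : ∀ u i → toℕ (omit u i) ≤ suc p
  toℕ-omit≤ u i = subst (_≤ suc p) (sym (Fin.toℕ-↑ˡ _ p)) (s≤s⁻¹ (Fin.toℕ<n (punchIn u i)))

  opposite-low-pen : opposite (low pen) ≡ low last
  opposite-low-pen = Fin.toℕ-injective (+-cancelʳ-≡ (suc p) _ _
    (trans (cong (toℕ (opposite (low pen)) +_) (cong suc (sym toℕ-low-pen)))
      (trans (opposite-sum (low pen))
        (sym (trans (cong (_+ suc p) (trans (Fin.toℕ-↑ˡ last p) (Fin.toℕ-fromℕ (suc p)))) (+-suc (suc p) p))))))

  opposite-low-last : opposite (low last) ≡ low pen
  opposite-low-last = trans (cong opposite (sym opposite-low-pen)) (Fin.opposite-involutive _)

  -- For u = v = last this is σ(i) = n + 1 − i on the first m = p + 1 points; any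
  -- other v (or u) shifts the innermost arc to a loop at m (respectively m + 1).
  Upper : (u v : Fin (suc (suc p))) → Pred (Permutation′ n′) 0ℓ
  Upper u v = Match (omit u) (opposite ∘ omit v)

  Upper₁ Upper₂ Lower Reverse : Pred (Permutation′ n′) 0ℓ
  Upper₁ σ = ∃[ v ] Upper last v σ
  Upper₂ σ = ∃[ u ] Upper u last σ
  Lower    = Match (opposite ∘ omit last) (omit last)
  Reverse  = Match id opposite

  -- The last terms of `a` and `b` are at least p. Their sum is at most 2p + 1 for an upper nesting,
  -- so only one of them can exceed p, and by at most one; for a lower nesting it is at most 2p, so
  -- both equal p.
  nesting⇒extremal : ∀ {σ} → Nesting σ (suc p) → ((Upper₁ ∪ Upper₂) ∪ Lower) σ
  nesting⇒extremal {σ} = λ where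
      (inj₁ N) → inj₁ (upper (upperNesting⇒pair N))
      (inj₂ N) → inj₂ (lower (lowerNesting⇒pair N))
    where
    initial : (a : Fin (suc p) → Fin n′) → StrictlyIncreasing (toℕ ∘ a) →
              toℕ (a (fromℕ p)) ≤ p → ∀ i → a i ≡ omit last i
    initial a inc bound i = Fin.toℕ-injective
      (trans (strictlyIncreasing⇒identity (toℕ ∘ a) inc bound i) (sym (toℕ-omit-last i)))

    omitting : (a : Fin (suc p) → Fin n′) → StrictlyIncreasing (toℕ ∘ a) →
               toℕ (a (fromℕ p)) ≤ suc p → ∃[ u ] ∀ i → a i ≡ omit u i
    omitting a inc bound =
      let (u , eq) = strictlyIncreasing⇒punchIn (toℕ ∘ a) inc (value≤gap+index (toℕ ∘ a) inc 1 bound)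
      in u , λ i → Fin.toℕ-injective (trans (eq i) (sym (Fin.toℕ-↑ˡ _ p)))

    upper : ∃[ a ] ∃[ b ] UpperPair σ p a b → (Upper₁ ∪ Upper₂) σ
    upper (a , b , a-inc , b-inc , s≤s sum≤ , s) with m≤n⇒m<n∨m≡n (last-index≤value a a-inc)
    ... | inj₂ p≡a = inj₁ (proj₁ b≗ , λ i →
          trans (cong (σ ⟨$⟩ʳ_) (sym (a≗ i))) (trans (s i) (cong opposite (proj₂ b≗ i))))
      where
      a≗ = initial a a-inc (≤-reflexive (sym p≡a))
      b≗ = omitting b b-inc (+-cancelˡ-≤ p _ _
        (subst (p + toℕ (b (fromℕ p)) ≤_) (sym (+-suc p p)) (≤-trans (+-monoˡ-≤ _ (≤-reflexive p≡a)) sum≤)))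
    ... | inj₁ p<a = inj₂ (proj₁ a≗ , λ i →
          trans (cong (σ ⟨$⟩ʳ_) (sym (proj₂ a≗ i))) (trans (s i) (cong opposite (b≗ i))))
      where
      a≗ = omitting a a-inc (+-cancelʳ-≤ p _ _ (≤-trans (+-monoʳ-≤ _ (last-index≤value b b-inc)) sum≤))
      b≗ = initial b b-inc (+-cancelˡ-≤ (suc p) _ _ (≤-trans (+-monoˡ-≤ _ p<a) sum≤))

    lower : ∃[ a ] ∃[ b ] LowerPair σ p a b → Lower σ
    lower (a , b , a-inc , b-inc , s≤s (s≤s sum≤) , s) i =
      trans (cong (λ x → σ ⟨$⟩ʳ opposite x) (sym (a≗ i))) (trans (s i) (b≗ i))
      where
      a≗ = initial a a-inc (+-cancelʳ-≤ p _ _ (≤-trans (+-monoʳ-≤ _ (last-index≤value b b-inc)) sum≤))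
      b≗ = initial b b-inc (+-cancelˡ-≤ p _ _ (≤-trans (+-monoˡ-≤ _ (last-index≤value a a-inc)) sum≤))

  extremal⇒nesting : ∀ {σ} → ((Upper₁ ∪ Upper₂) ∪ Lower) σ → Nesting σ (suc p)
  extremal⇒nesting (inj₁ (inj₁ (v , s))) = inj₁ (pair⇒upperNesting
    (omit-increasing last , omit-increasing v ,
     s≤s (≤-trans (+-mono-≤ (≤-reflexive toℕ-low-pen) (toℕ-omit≤ v (fromℕ p))) (≤-reflexive (+-suc p p))) , s))
  extremal⇒nesting (inj₁ (inj₂ (u , s))) = inj₁ (pair⇒upperNesting
    (omit-increasing u , omit-increasing last ,
     s≤s (+-mono-≤ (toℕ-omit≤ u (fromℕ p)) (≤-reflexive toℕ-low-pen)) , s))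
  extremal⇒nesting (inj₂ s) = inj₂ (pair⇒lowerNesting
    (omit-increasing last , omit-increasing last ,
     s≤s (s≤s (≤-reflexive (cong₂ _+_ toℕ-low-pen toℕ-low-pen))) , s))

  -- Counting the extremal families

  upper₁? : Decidable Upper₁
  upper₁? σ = any? λ v → match? (omit last) (opposite ∘ omit v) σ

  upper₂? : Decidable Upper₂
  upper₂? σ = any? λ u → match? (omit u) (opposite ∘ omit last) σ

  upper₁-resp : Upper₁ Respects Perm._≈_
  upper₁-resp {σ} {τ} eq (v , s) = v , match-resp (omit last) (opposite ∘ omit v) {σ} {τ} eq s

  upper₂-resp : Upper₂ Respects Perm._≈_
  upper₂-resp {σ} {τ} eq (u , s) = u , match-resp (omit u) (opposite ∘ omit last) {σ} {τ} eq s

  enumeration-upper : ∀ u v → Enumeration (Upper u v) (suc p !)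
  enumeration-upper u v = enumeration-match (omit u) (opposite ∘ omit v)
    (omit-injective u) (omit-injective v ∘ opposite-injective) (+-suc (suc p) p)

  -- The values on the first m points determine `punchIn v` and hence `v`, so the families for
  -- different `v` do not overlap.
  enumeration-upper₁ : Enumeration Upper₁ (suc (suc p) !)
  enumeration-upper₁ = enumeration-Σ
    (λ {v} {w} s t x≈y → punchIn-injectiveˡ λ i → low-injective (opposite-injective
      (trans (sym (s i)) (trans (x≈y (omit last i)) (t i)))))
    (enumeration-upper last)

  enumeration-upper₂ : Enumeration Upper₂ (suc (suc p) !)
  enumeration-upper₂ = enumeration-Σ
    -- Now `u` concerns the sources, so recovering it takes the injectivity of `σ`.
    (λ {u} {w} {σ} {τ} s t x≈y → punchIn-injectiveˡ λ i → low-injective (⟨$⟩ʳ-injective σ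
      (trans (s i) (trans (sym (t i)) (sym (x≈y (omit w i)))))))
    (λ u → enumeration-upper u last)

  enumeration-lower : Enumeration Lower (suc p !)
  enumeration-lower = enumeration-match (opposite ∘ omit last) (omit last)
    (omit-injective last ∘ opposite-injective) (omit-injective last) (+-suc (suc p) p)

  -- The members of Upper₁ ∩ Upper₂ outside Upper last last agree with i ↦ n + 1 − i
  -- on the first m − 1 points and have loops at m and m + 1.
  swap : Permutation′ (suc (suc p))
  swap = insert last pen Perm.id

  -- `swap` transposes the last two points and is its own inverse: it turns `punchIn last` into
  -- `punchIn pen` by construction, hence also conversely.
  swap-punchIn-pen : ∀ i → swap ⟨$⟩ʳ punchIn pen i ≡ punchIn last i
  swap-punchIn-pen i with i ≟ fromℕ p
  ... | yes refl = trans (cong (swap ⟨$⟩ʳ_) (punchIn-fromℕ p pen pen≢last)) (insert-at last pen Perm.id)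
  ... | no  i≢p  = trans (cong (swap ⟨$⟩ʳ_) (punchIn-penultimate p i i≢p))
    (trans (Perm.insert-punchIn last pen Perm.id i) (punchIn-penultimate p i i≢p))

  Swapped : Pred (Permutation′ n′) 0ℓ
  Swapped = Match low (opposite ∘ low ∘ (swap ⟨$⟩ʳ_))

  swapped⇒upper : ∀ σ → Swapped σ → (Upper₁ ∩ Upper₂) σ
  swapped⇒upper σ s =
    (pen , λ i → trans (s (punchIn last i)) (cong (opposite ∘ low) (Perm.insert-punchIn last pen Perm.id i))) ,
    (pen , λ i → trans (s (punchIn pen i)) (cong (opposite ∘ low) (swap-punchIn-pen i)))

  upper⇒swapped : ∀ σ → Upper last pen σ → Upper pen last σ → Swapped σ
  upper⇒swapped σ s t j with last ≟ j
  ... | no last≢j = trans (cong (σ ⟨$⟩ʳ_) (cong low (sym (Fin.punchIn-punchOut last≢j)))) (s (punchOut last≢j))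
  ... | yes refl  = trans (cong (σ ⟨$⟩ʳ_) (cong low (sym (punchIn-fromℕ p pen pen≢last)))) (t (fromℕ p))

  -- The sequence omitting `v` ends at `last`, whose reflection is `low pen`: the innermost arc is a
  -- loop.
  upper₁-last : ∀ σ {v} → v ≢ last → Upper last v σ → σ ⟨$⟩ʳ low pen ≡ low pen
  upper₁-last σ v≢ s = trans (s (fromℕ p))
    (trans (cong (opposite ∘ low) (punchIn-fromℕ p _ v≢)) opposite-low-last)

  upper₂-last : ∀ σ {u} → u ≢ last → Upper u last σ → σ ⟨$⟩ʳ low last ≡ low last
  upper₂-last σ u≢ s = trans (cong (σ ⟨$⟩ʳ_) (cong low (sym (punchIn-fromℕ p _ u≢))))
    (trans (s (fromℕ p)) opposite-low-pen)

  -- If neither index is `last`, both middle points carry loops, and this forces both indices to be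
  -- `pen`.
  upper₁∩upper₂⇒ : ∀ σ → (Upper₁ ∩ Upper₂) σ → (Upper last last ∪ Swapped) σ
  upper₁∩upper₂⇒ σ ((v , s) , (u , t)) with u ≟ last | v ≟ last
  ... | yes refl | _        = inj₁ t
  ... | no _     | yes refl = inj₁ s
  ... | no u≢    | no v≢    = inj₂ (upper⇒swapped σ
    (subst (λ v → Upper last v σ) v≡pen s) (subst (λ u → Upper u last σ) u≡pen t))
    where
    u≡pen : u ≡ pen
    u≡pen with u ≟ pen
    ... | yes eq    = eq
    -- The loop at `low pen` would be an arc of the nesting `t`, whose targets all lie beyond the
    -- first m points.
    ... | no  u≢pen = contradiction
      (low-injective (opposite-injective (trans (sym (t i))
        (trans (cong (λ x → σ ⟨$⟩ʳ low x) (Fin.punchIn-punchOut u≢pen))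
          (trans (upper₁-last σ v≢ s) (sym opposite-low-last))))))
      (Fin.punchInᵢ≢i last i)
      where i = punchOut u≢pen

    v≡pen : v ≡ pen
    v≡pen with v ≟ pen
    ... | yes eq    = eq
    -- The looped point `low last` would be the target of one of the first m points.
    ... | no  v≢pen = contradiction
      (low-injective (⟨$⟩ʳ-injective σ (trans (s i)
        (trans (cong (opposite ∘ low) (Fin.punchIn-punchOut v≢pen))
          (trans opposite-low-pen (sym (upper₂-last σ u≢ t)))))))
      (Fin.punchInᵢ≢i last i)
      where i = punchOut v≢pen

  enumeration-upper₁∩upper₂ : Enumeration (Upper₁ ∩ Upper₂) (suc p ! + p !)
  enumeration-upper₁∩upper₂ = enumeration-⇔
    (λ {σ} → [ (λ s → (last , s) , (last , s)) , swapped⇒upper σ ]′)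
    (λ {σ} → upper₁∩upper₂⇒ σ)
    (enumeration-⊎ (λ {σ} {τ} → disjoint {σ} {τ}) (enumeration-upper last last)
      (enumeration-match low (opposite ∘ low ∘ (swap ⟨$⟩ʳ_)) low-injective
        (⟨$⟩ʳ-injective swap ∘ low-injective ∘ opposite-injective) refl))
    where
    disjoint : ∀ {σ τ} → Upper last last σ → Swapped τ → ¬ σ Perm.≈ τ
    -- `σ` sends `low pen` to `low last`, whereas `τ` fixes it.
    disjoint {σ} {τ} s t σ≈τ = pen≢last (low-injective (opposite-injective
      (trans (sym (s (fromℕ p))) (trans (σ≈τ (low pen))
        (trans (upper₁-last τ pen≢last (proj₂ (proj₁ (swapped⇒upper τ t)))) (sym opposite-low-last))))))

  -- Upper and lower nestings in one permutation

  reverse⇒ : ∀ σ → Reverse σ → ((Upper₁ ∪ Upper₂) ∩ Lower) σ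
  reverse⇒ σ s = inj₁ (last , λ i → s (omit last i)) ,
    λ i → trans (s (opposite (omit last i))) (Fin.opposite-involutive _)

  -- The lower nesting sends `low last` to `low pen`, which excludes a loop at either middle point
  -- and leaves `Upper last last`. The upper arcs then fix `σ` on the first half, the lower arcs on
  -- the second.
  upper∩lower⇒reverse : ∀ σ → ((Upper₁ ∪ Upper₂) ∩ Lower) σ → Reverse σ
  upper∩lower⇒reverse σ (upper , t) = λ x → halves x (≤-total (toℕ x) p)
    where
    t-pen : σ ⟨$⟩ʳ low last ≡ low pen
    t-pen = trans (cong (σ ⟨$⟩ʳ_) (sym opposite-low-pen)) (t (fromℕ p))

    both-last : (Upper₁ ∪ Upper₂) σ → Upper last last σ
    both-last (inj₁ (v , s)) with v ≟ last
    ... | yes refl = s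
    ... | no v≢    = contradiction
      (low-injective (⟨$⟩ʳ-injective σ (trans (upper₁-last σ v≢ s) (sym t-pen)))) pen≢last
    both-last (inj₂ (u , s)) with u ≟ last
    ... | yes refl = s
    ... | no u≢    = contradiction
      (low-injective (trans (sym t-pen) (upper₂-last σ u≢ s))) pen≢last

    s : Upper last last σ
    s = both-last upper

    low-half : ∀ x → toℕ x ≤ p → ∃[ i ] omit last i ≡ x
    low-half x x≤p = Fin.fromℕ< (s≤s x≤p) ,
      Fin.toℕ-injective (trans (toℕ-omit-last _) (Fin.toℕ-fromℕ< (s≤s x≤p)))

    opposite≤p : ∀ x → p < toℕ x → toℕ (opposite x) ≤ p
    opposite≤p x p<x = +-cancelʳ-≤ (suc (toℕ x)) _ _ (begin
      toℕ (opposite x) + suc (toℕ x)    ≡⟨ opposite-sum x ⟩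
      suc (suc (p + p))                 ≡⟨ cong suc (+-suc p p) ⟨
      suc (p + suc p)                   ≡⟨ +-suc p (suc p) ⟨
      p + suc (suc p)                   ≤⟨ +-monoʳ-≤ p (s≤s p<x) ⟩
      p + suc (toℕ x)                   ∎)
      where open ≤-Reasoning

    halves : ∀ x → toℕ x ≤ p ⊎ p ≤ toℕ x → σ ⟨$⟩ʳ x ≡ opposite x
    halves x (inj₁ x≤p) with (i , refl) ← low-half x x≤p = s i
    halves x (inj₂ p≤x) with m≤n⇒m<n∨m≡n p≤x
    ... | inj₂ p≡x with (i , refl) ← low-half x (≤-reflexive (sym p≡x)) = s i
    ... | inj₁ p<x with (i , eq) ← low-half (opposite x) (opposite≤p x p<x) =
      trans (cong (σ ⟨$⟩ʳ_) (trans (sym (Fin.opposite-involutive x)) (cong opposite (sym eq))))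
        (trans (t i) eq)

  NE-even : NE n′ [ ⌈ n′ /2⌉ ]≔ (2 * (suc p + 1) ! ∸ p ! ∸ 1)
  NE-even
    with (d , e , d≡) ← inclusion-exclusion upper₁?
                          (λ {σ} {τ} → upper₁-resp {σ} {τ}) (λ {σ} {τ} → upper₂-resp {σ} {τ})
                          enumeration-upper₁ enumeration-upper₂ enumeration-upper₁∩upper₂
    with (c , f , c≡) ← inclusion-exclusion {P = Upper₁ ∪ Upper₂} {Q = Lower}
                          (λ σ → upper₁? σ ⊎-dec upper₂? σ)
                          (λ {σ} {τ} eq → [ inj₁ ∘ upper₁-resp {σ} {τ} eq , inj₂ ∘ upper₂-resp {σ} {τ} eq ]′)
                          (λ {σ} {τ} → match-resp (opposite ∘ omit last) (omit last) {σ} {τ})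
                          e enumeration-lower
                          (enumeration-⇔ (λ {σ} → reverse⇒ σ) (λ {σ} → upper∩lower⇒reverse σ)
                            -- With every value prescribed, 0! = 1 permutation remains.
                            (enumeration-match {r = 0} id opposite id opposite-injective (+-identityʳ _)))
    = subst (NE n′ [ ⌈ n′ /2⌉ ]≔_) count
        (enumeration⇒NE (enumeration-⇔ extremal⇒nesting nesting⇒extremal f) (cong suc (n≡⌈n+n/2⌉ p)))
    where
    open ≡-Reasoning

    -- The m! permutations with a lower nesting cancel the m! in the overlap of `Upper₁` and
    -- `Upper₂`, so only (m - 1)! and 1 remain to be subtracted.
    total : c + 1 + p ! ≡ 2 * (suc p + 1) !
    total = begin
      c + 1 + p !                               ≡⟨ cong (_+ p !) c≡ ⟩
      d + suc p ! + p !                         ≡⟨ +-assoc d (suc p !) (p !) ⟩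
      d + (suc p ! + p !)                       ≡⟨ d≡ ⟩
      suc (suc p) ! + suc (suc p) !             ≡⟨ cong (suc (suc p) ! +_) (+-identityʳ _) ⟨
      2 * suc (suc p) !                         ≡⟨ cong (λ k → 2 * k !) (+-comm 1 (suc p)) ⟩
      2 * (suc p + 1) !                         ∎

    count : c ≡ 2 * (suc p + 1) ! ∸ p ! ∸ 1
    count = begin
      c                                         ≡⟨ m+n∸n≡m c 1 ⟨
      c + 1 ∸ 1                                 ≡⟨ cong (_∸ 1) (m+n∸n≡m (c + 1) (p !)) ⟨
      c + 1 + p ! ∸ p ! ∸ 1                     ≡⟨ cong (λ x → x ∸ p ! ∸ 1) total ⟩
      2 * (suc p + 1) ! ∸ p ! ∸ 1               ∎

-- The two parities together

theorem2 : (n : ℕ) → 1 ≤ n →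
    ((m : ℕ) → n ≡ 2 * m + 1 → NE n [ ⌈ n /2⌉ ]≔ (m !))
    × ((m : ℕ) → n ≡ 2 * m → NE n [ ⌈ n /2⌉ ]≔ (2 * (m + 1) ! ∸ (m ∸ 1) ! ∸ 1))
theorem2 n 1≤n = odd , even
  where
  odd : (m : ℕ) → n ≡ 2 * m + 1 → NE n [ ⌈ n /2⌉ ]≔ (m !)
  odd m n≡ = subst (λ n → NE n [ ⌈ n /2⌉ ]≔ (m !)) (sym n≡′) (Odd.NE-odd m)
    where
    n≡′ : n ≡ suc m + m
    n≡′ = trans n≡ (trans (+-comm (2 * m) 1) (cong (λ k → suc (m + k)) (+-identityʳ m)))

  even : (m : ℕ) → n ≡ 2 * m → NE n [ ⌈ n /2⌉ ]≔ (2 * (m + 1) ! ∸ (m ∸ 1) ! ∸ 1)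
  -- As n is positive, so is m, and `m ∸ 1` is never truncated.
  even zero    n≡ = contradiction (subst (1 ≤_) n≡ 1≤n) λ ()
  even (suc p) n≡ =
    subst (λ n → NE n [ ⌈ n /2⌉ ]≔ (2 * (suc p + 1) ! ∸ p ! ∸ 1)) (sym n≡′) (Even.NE-even p)
    where
    n≡′ : n ≡ suc (suc p) + p
    n≡′ = trans n≡ (trans (cong (suc p +_) (+-identityʳ (suc p))) (+-suc (suc p) p))
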